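{- Let $n\ge 1$, let $S$ and $R$ be nonempty subsets of $\{0,1\}^n$, and let $w$ be a positive integer. Then the following conditions are equivalent: (1) Player I has a winning strategy in the game $\mathrm{EF}_w(S,R)$. (2) There is a propositional formula $\phi$ of size $\mathrm{w}(\phi)\le w$ such that $(S,R)\models\phi$.
   Context: Fix $n\ge 1$. Strings are elements $s=s_1\ldots s_n$ of $\{0,1\}^n$; a string property is a nonempty set of strings. Propositional formulas are built from the propositional symbols $p_1,\ldots,p_n$ by $\neg,\wedge,\vee$. Satisfaction: $s\models p_i$ iff $s_i=1$, and $\neg,\wedge,\vee$ are interpreted as usual. Size: $\mathrm{w}(p_i)=1$, $\mathrm{w}(\neg\phi)=\mathrm{w}(\phi)$, $\mathrm{w}(\phi\vee\psi)=\mathrm{w}(\phi\wedge\psi)=\mathrm{w}(\phi)+\mathrm{w}(\psi)$. Separation: for sets of strings $S,R$, $(S,R)\models\phi$ means $s\models\phi$ for all $s\in S$ and $r\not\models\phi$ for all $r\in R$. The game $\mathrm{EF}_w(S,R)$ ($w$ a positive integer, called the rank) has two players, I and II. Positions are triples $(w_m,S_m,R_m)$ with $w_m$ a positive integer and $S_m,R_m$ sets of strings (the parts produced by splitting moves may be empty). The initial position is $(w,S,R)$. If in position $(w_m,S_m,R_m)$ there is $i$ with $(S_m,R_m)\models p_i$ or $(S_m,R_m)\models\neg p_i$, the game ends and player I wins. Otherwise, if $w_m=1$, the game ends and player II wins. Otherwise player I makes one of the following moves. Left splitting move: player I chooses integers $u,v\ge 1$ with $u+v=w_m$ and sets $C,D$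 with $S_m=C\cup D$; player II chooses whether the game continues from $(u,C,R_m)$ or from $(v,D,R_m)$. Right splitting move: player I chooses integers $u,v\ge 1$ with $u+v=w_m$ and sets $C,D$ with $R_m=C\cup D$; player II chooses whether the game continues from $(u,S_m,C)$ or from $(v,S_m,D)$. -}

module Defs where

open import Data.Bool using (Bool; true; T)
open import Data.Fin using (Fin)
open import Data.Nat using (ℕ; _+_; _≥_)
open import Data.Product using (Σ; _×_)
open import Data.Sum using (_⊎_)
open import Data.Vec using (Vec; lookup)
open import Function using (_∘_)
open import Level using (0ℓ)
open import Relation.Binary.PropositionalEquality using (_≡_; _≢_)
open import Relation.Nullary using (¬_)
open import Relation.Unary using (Pred; _∪_; _≐_)

BitString : ℕ → Set
BitString n = Vec Bool n

-- Subsets of the finite set {0,1}ⁿ are given by their characteristic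
-- functions, so that membership is decidable.  Equality of sets is always
-- taken to be extensional (_≐_ on the associated predicates).
StringSet : ℕ → Set
StringSet n = BitString n → Bool

⟦_⟧ : ∀ {n} → StringSet n → Pred (BitString n) 0ℓ
⟦ S ⟧ = T ∘ S

infix  8 ¬'_
infixr 7 _∧'_
infixr 6 _∨'_

data Formula (n : ℕ) : Set where
  p    : Fin n → Formula n
  ¬'_  : Formula n → Formula n
  _∧'_ : Formula n → Formula n → Formula n
  _∨'_ : Formula n → Formula n → Formula n

infix 4 _⊨_ ⟨_,_⟩⊨_

_⊨_ : ∀ {n} → BitString n → Formula n → Set
s ⊨ p i      = lookup s i ≡ true
s ⊨ ¬' φ     = ¬ (s ⊨ φ)
s ⊨ φ ∧' ψ   = (s ⊨ φ) × (s ⊨ ψ)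
s ⊨ φ ∨' ψ   = (s ⊨ φ) ⊎ (s ⊨ ψ)

size : ∀ {n} → Formula n → ℕ
size (p i)    = 1
size (¬' φ)   = size φ
size (φ ∧' ψ) = size φ + size ψ
size (φ ∨' ψ) = size φ + size ψ

⟨_,_⟩⊨_ : ∀ {n} → StringSet n → StringSet n → Formula n → Set
⟨ S , R ⟩⊨ φ = (∀ s → T (S s) → s ⊨ φ) × (∀ r → T (R r) → ¬ (r ⊨ φ))

record Position (n : ℕ) : Set where
  constructor position
  field
    rank   : ℕ
    rank≥1 : rank ≥ 1
    left   : StringSet n
    right  : StringSet n

open Position public

module _ {n : ℕ} where

  WonByI : Position n → Set
  WonByI P = Σ (Fin n) λ i →
    (⟨ left P , right P ⟩⊨ p i) ⊎ (⟨ left P , right P ⟩⊨ ¬' p i)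

  WonByII : Position n → Set
  WonByII P = ¬ WonByI P × rank P ≡ 1

  Ended : Position n → Set
  Ended P = WonByI P ⊎ WonByII P

  Ongoing : Position n → Set
  Ongoing P = ¬ WonByI P × rank P ≢ 1

  data Move (P : Position n) : Set where
    splitLeft  : (u v : ℕ) → u ≥ 1 → v ≥ 1 → u + v ≡ rank P →
                 (C D : StringSet n) → ⟦ left P ⟧ ≐ (⟦ C ⟧ ∪ ⟦ D ⟧) → Move P
    splitRight : (u v : ℕ) → u ≥ 1 → v ≥ 1 → u + v ≡ rank P →
                 (C D : StringSet n) → ⟦ right P ⟧ ≐ (⟦ C ⟧ ∪ ⟦ D ⟧) → Move P

  data Answer : Set where
    first second : Answer

  next : (P : Position n) → Move P → Answer → Position n
  next P (splitLeft  u v u≥1 v≥1 _ C D _) first  = position u u≥1 C (right P)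
  next P (splitLeft  u v u≥1 v≥1 _ C D _) second = position v v≥1 D (right P)
  next P (splitRight u v u≥1 v≥1 _ C D _) first  = position u u≥1 (left P) C
  next P (splitRight u v u≥1 v≥1 _ C D _) second = position v v≥1 (left P) D

  -- Play P Q: the finite (partial) plays that start in P and have reached Q.
  -- Since u and v are positive, the rank strictly decreases with every round,
  -- so there are no infinite plays to account for.
  data Play (P : Position n) : Position n → Set where
    start : Play P P
    round : ∀ {Q} → Play P Q → .(Ongoing Q) →
            (m : Move Q) (a : Answer) → Play P (next Q m a)

  -- A strategy for player I may depend on the whole history.  The proof that
  -- the game has not ended is irrelevant, so the move depends on nothing else.
  Strategy : Position n → Set
  Strategy P = ∀ {Q} → Play P Q → .(Ongoing Q) → Move Q

  data Follows {P : Position n} (σ : Strategy P) :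
               ∀ {Q} → Play P Q → Set where
    start : Follows σ start
    round : ∀ {Q} {π : Play P Q} → Follows σ π →
            .(o : Ongoing Q) (a : Answer) → Follows σ (round π o (σ π o) a)

  Winning : {P : Position n} → Strategy P → Set
  Winning {P} σ = ∀ {Q} (π : Play P Q) → Follows σ π → Ended Q → WonByI Q

  HasWinningStrategy : Position n → Set
  HasWinningStrategy P = Σ (Strategy P) λ σ → Winning {P} σ

{-# OPTIONS --safe #-}
module Submission where

-- A formula is a recipe for player I: at a disjunction split S into the strings
-- satisfying the first disjunct and the rest, at a conjunction split R dually,
-- and at a negation exchange the roles of S and R.  At each round the formula is
-- replaced by the subformula for the component that player II picked; the
-- current formula keeps separating the current position within its rank.
-- Conversely, splitting moves on the left and on the right of a winning strategy
-- are read off as disjunctions and conjunctions.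

open import Data.Bool using (T; _∧_)
open import Data.Bool.Properties using (T-∧; T?) renaming (_≟_ to _≟ᵇ_)
open import Data.Empty using (⊥-elim; ⊥-elim-irr)
open import Data.Fin.Properties using (any?)
open import Data.Fin.Subset.Properties using (anySubset?)
open import Data.Nat using (ℕ; zero; suc; _+_; _∸_; _≤_; _<_; _≥_; _≤?_; z≤n; s≤s)
open import Data.Nat.Induction using (<-wellFounded)
open import Data.Nat.Properties
  using (_≟_; ≤-refl; ≤-reflexive; ≤-trans; <⇒≱; +-comm; +-mono-≤; m≤m+n; m<m+n; m<n+m;
         m+[n∸m]≡n; m+n≤o⇒m≤o; m+n≤o⇒m≤o∸n)
open import Data.Product using (Σ; _×_; _,_; proj₁; proj₂)
open import Data.Sum using (_⊎_; inj₁; inj₂; [_,_]′; swap)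
open import Data.Vec using (lookup)
open import Function using (_∘_; id)
open import Function.Bundles using (_⇔_; mk⇔; Equivalence)
open import Induction.WellFounded using (Acc; acc)
open import Relation.Binary.PropositionalEquality using (_≡_; _≢_; refl)
open import Relation.Nullary using (¬_; Dec; yes; no)
open import Relation.Nullary.Decidable
  using (⌊_⌋; ¬?; toSum; _×-dec_; _⊎-dec_; _→-dec_; map′; decidable-stable; toWitness; fromWitness)
open import Relation.Unary using (Satisfiable; _∪_; _≐_; Decidable)
open import Defs

private variable
  n : ℕ

-- Decidability over the finite set of strings

infix 4 _⊨?_

_⊨?_ : (s : BitString n) (φ : Formula n) → Dec (s ⊨ φ)
s ⊨? p i    = lookup s i ≟ᵇ _
s ⊨? ¬' φ   = ¬? (s ⊨? φ)
s ⊨? φ ∧' ψ = (s ⊨? φ) ×-dec (s ⊨? ψ)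
s ⊨? φ ∨' ψ = (s ⊨? φ) ⊎-dec (s ⊨? ψ)

-- A bit string is a `Subset n`, so `anySubset?` can search for a counterexample.
all? : {P : BitString n → Set} → Decidable P → Dec (∀ s → P s)
all? P? = map′ (λ ¬∃ s → decidable-stable (P? s) (λ ¬Ps → ¬∃ (s , ¬Ps)))
               (λ ∀P (s , ¬Ps) → ¬Ps (∀P s))
               (¬? (anySubset? (λ s → ¬? (P? s))))

separates? : (S R : StringSet n) (φ : Formula n) → Dec (⟨ S , R ⟩⊨ φ)
separates? S R φ =
  all? (λ s → T? (S s) →-dec (s ⊨? φ)) ×-dec all? (λ r → T? (R r) →-dec ¬? (r ⊨? φ))

wonByI? : (P : Position n) → Dec (WonByI P)
wonByI? P = any? λ i →
  separates? (left P) (right P) (p i) ⊎-dec separates? (left P) (right P) (¬' p i)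

separates-¬⁺ : {S R : StringSet n} (φ : Formula n) → ⟨ S , R ⟩⊨ φ → ⟨ R , S ⟩⊨ ¬' φ
separates-¬⁺ φ (S⊨φ , R⊭φ) = R⊭φ , λ s s∈S s⊭φ → s⊭φ (S⊨φ s s∈S)

separates-¬⁻ : {S R : StringSet n} (φ : Formula n) → ⟨ S , R ⟩⊨ ¬' φ → ⟨ R , S ⟩⊨ φ
separates-¬⁻ φ (S⊭φ , R⊨¬¬φ) =
  (λ r r∈R → decidable-stable (r ⊨? φ) (R⊨¬¬φ r r∈R)) , S⊭φ

Separates : Formula n → Position n → Set
Separates φ P = (size φ ≤ rank P) × (⟨ left P , right P ⟩⊨ φ)

1≤size : (φ : Formula n) → 1 ≤ size φ
1≤size (p i)    = s≤s z≤n
1≤size (¬' φ)   = 1≤size φ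
1≤size (φ ∧' ψ) = ≤-trans (1≤size φ) (m≤m+n _ _)
1≤size (φ ∨' ψ) = ≤-trans (1≤size φ) (m≤m+n _ _)

-- From a winning strategy to a formula

wonByI⇒separable : (P : Position n) → WonByI P → Σ (Formula n) λ φ → Separates φ P
wonByI⇒separable P (i , inj₁ sep) = p i , rank≥1 P , sep
wonByI⇒separable P (i , inj₂ sep) = ¬' p i , rank≥1 P , sep

-- After a left split, each left string satisfies the formula of its part while each right string
-- refutes both, so their disjunction separates; right splits are dual. Sizes add up just as ranks
-- do.
combine : (P : Position n) (m : Move P) →
          (∀ a → Σ (Formula n) λ φ → Separates φ (next P m a)) →
          Σ (Formula n) λ φ → Separates φ P
combine P (splitLeft u v _ _ u+v≡w C D (S⊆C∪D , _)) sub with sub first | sub second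
... | φ , φ≤u , C⊨φ , R⊭φ | ψ , ψ≤v , D⊨ψ , R⊭ψ =
  φ ∨' ψ
  , ≤-trans (+-mono-≤ φ≤u ψ≤v) (≤-reflexive u+v≡w)
  , (λ s s∈S → [ inj₁ ∘ C⊨φ s , inj₂ ∘ D⊨ψ s ]′ (S⊆C∪D s∈S))
  , λ r r∈R → [ R⊭φ r r∈R , R⊭ψ r r∈R ]′
combine P (splitRight u v _ _ u+v≡w C D (R⊆C∪D , _)) sub with sub first | sub second
... | φ , φ≤u , S⊨φ , C⊭φ | ψ , ψ≤v , S⊨ψ , D⊭ψ =
  φ ∧' ψ
  , ≤-trans (+-mono-≤ φ≤u ψ≤v) (≤-reflexive u+v≡w)
  , (λ s s∈S → S⊨φ s s∈S , S⊨ψ s s∈S)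
  , λ r r∈R (r⊨φ , r⊨ψ) → [ (λ r∈C → C⊭φ r r∈C r⊨φ) , (λ r∈D → D⊭ψ r r∈D r⊨ψ) ]′ (R⊆C∪D r∈R)

rank-next-< : (P : Position n) (m : Move P) (a : Answer {n}) → rank (next P m a) < rank P
rank-next-< P (splitLeft  u v u≥1 v≥1 refl _ _ _) first  = m<m+n u v≥1
rank-next-< P (splitLeft  u v u≥1 v≥1 refl _ _ _) second = m<n+m v u≥1
rank-next-< P (splitRight u v u≥1 v≥1 refl _ _ _) first  = m<m+n u v≥1
rank-next-< P (splitRight u v u≥1 v≥1 refl _ _ _) second = m<n+m v u≥1

winning⇒separable : {P : Position n} (σ : Strategy P) → Winning σ →
                    ∀ {Q} (π : Play P Q) → Follows σ π → Acc _<_ (rank Q) →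
                    Σ (Formula n) λ φ → Separates φ Q
winning⇒separable σ win {Q} π π-σ (acc rs) with wonByI? Q | rank Q ≟ 1
... | yes won | _        = wonByI⇒separable Q won
-- Player II would have won here, although the play follows `σ`.
... | no ¬won | yes w≡1  = ⊥-elim (¬won (win π π-σ (inj₂ (¬won , w≡1))))
... | no ¬won | no w≢1   = combine Q m λ a →
  winning⇒separable σ win (round π ongoing m a) (round π-σ ongoing a) (rs (rank-next-< Q m a))
  where
  ongoing : Ongoing Q
  ongoing = ¬won , w≢1

  m : Move Q
  m = σ π ongoing

-- From a formula to a winning strategy

_∩_ _∖_ : StringSet n → Formula n → StringSet n
(S ∩ φ) s = S s ∧ ⌊ s ⊨? φ ⌋
(S ∖ φ) s = (S ∩ (¬' φ)) s

∈-∩⁺ : (S : StringSet n) (φ : Formula n) {s : BitString n} → T (S s) → s ⊨ φ → T ((S ∩ φ) s)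
∈-∩⁺ S φ {s} s∈S s⊨φ = Equivalence.from T-∧ (s∈S , fromWitness {a? = s ⊨? φ} s⊨φ)

∈-∩⁻ : (S : StringSet n) (φ : Formula n) {s : BitString n} → T ((S ∩ φ) s) → T (S s) × s ⊨ φ
∈-∩⁻ S φ {s} s∈ with s∈S , s⊨φ ← Equivalence.to (T-∧ {S s}) s∈ = s∈S , toWitness {a? = s ⊨? φ} s⊨φ

∩∪∖ : (S : StringSet n) (φ : Formula n) → ⟦ S ⟧ ≐ (⟦ S ∩ φ ⟧ ∪ ⟦ S ∖ φ ⟧)
∩∪∖ {n} S φ = split , [ proj₁ ∘ ∈-∩⁻ S φ , proj₁ ∘ ∈-∩⁻ S (¬' φ) ]′
  where
  split : {s : BitString n} → T (S s) → T ((S ∩ φ) s) ⊎ T ((S ∖ φ) s)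
  split {s} s∈S = [ (λ s⊨φ → inj₁ (∈-∩⁺ S φ s∈S s⊨φ)) , (λ s⊭φ → inj₂ (∈-∩⁺ S (¬' φ) s∈S s⊭φ)) ]′
    (toSum (s ⊨? φ))

-- This order is for conjunctions: the part handled by the first conjunct `φ` consists of the
-- strings that refute it.
∖∪∩ : (S : StringSet n) (φ : Formula n) → ⟦ S ⟧ ≐ (⟦ S ∖ φ ⟧ ∪ ⟦ S ∩ φ ⟧)
∖∪∩ S φ = swap ∘ proj₁ (∩∪∖ S φ) , proj₂ (∩∪∖ S φ) ∘ swap

-- Negation costs neither rank nor a round: `¬' φ` is played as `φ` with the two sets exchanged.
dual : Position n → Position n
dual (position w w≥1 S R) = position w w≥1 R S

dualMove : (P : Position n) → Move (dual P) → Move P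
dualMove P (splitLeft  u v u≥1 v≥1 u+v≡w C D eq) = splitRight u v u≥1 v≥1 u+v≡w C D eq
dualMove P (splitRight u v u≥1 v≥1 u+v≡w C D eq) = splitLeft  u v u≥1 v≥1 u+v≡w C D eq

dual-wonByI : (P : Position n) → WonByI (dual P) → WonByI P
dual-wonByI P (i , inj₁ sep) = i , inj₂ (separates-¬⁺ (p i) sep)
dual-wonByI P (i , inj₂ sep) = i , inj₁ (separates-¬⁻ (p i) sep)

dual-separates⁺ : (P : Position n) (m : Move (dual P)) (a : Answer {n}) (φ : Formula n) →
                  Separates φ (next (dual P) m a) → Separates (¬' φ) (next P (dualMove P m) a)
dual-separates⁺ P (splitLeft  _ _ _ _ _ _ _ _) first  φ (le , sep) = le , separates-¬⁺ φ sep
dual-separates⁺ P (splitLeft  _ _ _ _ _ _ _ _) second φ (le , sep) = le , separates-¬⁺ φ sep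
dual-separates⁺ P (splitRight _ _ _ _ _ _ _ _) first  φ (le , sep) = le , separates-¬⁺ φ sep
dual-separates⁺ P (splitRight _ _ _ _ _ _ _ _) second φ (le , sep) = le , separates-¬⁺ φ sep

anyMove : (P : Position n) → .(rank P ≢ 1) → Move P
anyMove (position (suc zero)    _ S R) w≢1 = ⊥-elim-irr (w≢1 refl)
anyMove (position (suc (suc w)) _ S R) _   =
  -- The left set is covered by two copies of itself.
  splitLeft 1 (suc w) (s≤s z≤n) (s≤s z≤n) refl S S (inj₁ , [ id , id ]′)

-- The two ranks must add up exactly, so the second component receives all that the first subformula
-- leaves; this bounds its size.
m+n≤o⇒n≤o∸m : ∀ m {n o} → m + n ≤ o → n ≤ o ∸ m
m+n≤o⇒n≤o∸m m {n} le = m+n≤o⇒m≤o∸n n (≤-trans (≤-reflexive (+-comm n m)) le)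

-- Total in φ, since a strategy must also answer plays that deviate from it and
-- in which φ may be too large; anyMove fills these cases.
move : Formula n → (P : Position n) → .(rank P ≢ 1) → Move P
move (p i)    P w≢1 = anyMove P w≢1
move (¬' φ)   P w≢1 = dualMove P (move φ (dual P) w≢1)
move (φ ∧' ψ) P w≢1 with size φ + size ψ ≤? rank P
... | yes le = splitRight (size φ) (rank P ∸ size φ) (1≤size φ)
                 (≤-trans (1≤size ψ) (m+n≤o⇒n≤o∸m (size φ) le))
                 (m+[n∸m]≡n (m+n≤o⇒m≤o (size φ) le))
                 (right P ∖ φ) (right P ∩ φ) (∖∪∩ (right P) φ)
... | no _   = anyMove P w≢1
move (φ ∨' ψ) P w≢1 with size φ + size ψ ≤? rank P
... | yes le = splitLeft (size φ) (rank P ∸ size φ) (1≤size φ)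
                 (≤-trans (1≤size ψ) (m+n≤o⇒n≤o∸m (size φ) le))
                 (m+[n∸m]≡n (m+n≤o⇒m≤o (size φ) le))
                 (left P ∩ φ) (left P ∖ φ) (∩∪∖ (left P) φ)
... | no _   = anyMove P w≢1

-- A negation stays in front because the sets are exchanged back after the move. The value at `p i`
-- is a dummy: a position that `p i` separates is already won.
residual : Formula n → Answer {n} → Formula n
residual (p i)    a      = p i
residual (¬' φ)   a      = ¬' residual φ a
residual (φ ∧' ψ) first  = φ
residual (φ ∧' ψ) second = ψ
residual (φ ∨' ψ) first  = φ
residual (φ ∨' ψ) second = ψ

-- The invariant survives a round: a left string that fails `φ` but satisfies `φ ∨' ψ` must satisfy
-- `ψ`, and dually on the right for `φ ∧' ψ`.
residual-separates : (φ : Formula n) (P : Position n) .(w≢1 : rank P ≢ 1) → .(¬ WonByI P) →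
                     Separates φ P → (a : Answer {n}) →
                     Separates (residual φ a) (next P (move φ P w≢1) a)
residual-separates (p i) P w≢1 ¬won (_ , sep) a = ⊥-elim-irr (¬won (i , inj₁ sep))
residual-separates (¬' φ) P w≢1 ¬won (le , sep) a =
  dual-separates⁺ P (move φ (dual P) w≢1) a (residual φ a)
    (residual-separates φ (dual P) w≢1 (λ won → ¬won (dual-wonByI P won)) (le , separates-¬⁻ φ sep) a)
residual-separates (φ ∧' ψ) P w≢1 ¬won (le , S⊨ , R⊭) a with size φ + size ψ ≤? rank P
... | no ≰ = ⊥-elim (≰ le)
residual-separates (φ ∧' ψ) P w≢1 ¬won (_ , S⊨ , R⊭) first | yes _ =
  ≤-refl , (λ s → proj₁ ∘ S⊨ s) , λ r → proj₂ ∘ ∈-∩⁻ (right P) (¬' φ)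
residual-separates (φ ∧' ψ) P w≢1 ¬won (_ , S⊨ , R⊭) second | yes le =
  m+n≤o⇒n≤o∸m (size φ) le , (λ s → proj₂ ∘ S⊨ s) ,
  λ r r∈ r⊨ψ → let r∈R , r⊨φ = ∈-∩⁻ (right P) φ r∈ in R⊭ r r∈R (r⊨φ , r⊨ψ)
residual-separates (φ ∨' ψ) P w≢1 ¬won (le , S⊨ , R⊭) a with size φ + size ψ ≤? rank P
... | no ≰ = ⊥-elim (≰ le)
residual-separates (φ ∨' ψ) P w≢1 ¬won (_ , S⊨ , R⊭) first | yes _ =
  ≤-refl , (λ s → proj₂ ∘ ∈-∩⁻ (left P) φ) , λ r r∈R → R⊭ r r∈R ∘ inj₁
residual-separates (φ ∨' ψ) P w≢1 ¬won (_ , S⊨ , R⊭) second | yes le =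
  m+n≤o⇒n≤o∸m (size φ) le ,
  (λ s s∈ → let s∈S , s⊭φ = ∈-∩⁻ (left P) (¬' φ) s∈
            in [ ⊥-elim ∘ s⊭φ , id ]′ (S⊨ s s∈S)) ,
  λ r r∈R → R⊭ r r∈R ∘ inj₂

-- A binary connective has size at least 2, so only a symbol under negations remains.
separates-rank1 : (φ : Formula n) (P : Position n) → rank P ≡ 1 → Separates φ P → WonByI P
separates-rank1 (p i)    P w≡1 (_ , sep)  = i , inj₁ sep
separates-rank1 (¬' φ)   P w≡1 (le , sep) =
  dual-wonByI P (separates-rank1 φ (dual P) w≡1 (le , separates-¬⁻ φ sep))
separates-rank1 (φ ∧' ψ) P refl (le , _) =
  ⊥-elim (<⇒≱ (+-mono-≤ (1≤size φ) (1≤size ψ)) le)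
separates-rank1 (φ ∨' ψ) P refl (le , _) =
  ⊥-elim (<⇒≱ (+-mono-≤ (1≤size φ) (1≤size ψ)) le)

-- Only player II's answers are read off; the link to the position reached is established for plays
-- that follow `formulaStrategy`.
currentFormula : {P Q : Position n} → Formula n → Play P Q → Formula n
currentFormula φ start           = φ
currentFormula φ (round π _ _ a) = residual (currentFormula φ π) a

formulaStrategy : {P : Position n} → Formula n → Strategy P
formulaStrategy φ {Q} π ongoing = move (currentFormula φ π) Q (proj₂ ongoing)

follows⇒separates : {P Q : Position n} (φ : Formula n) → Separates φ P → {π : Play P Q} →
                    Follows (formulaStrategy φ) π → Separates (currentFormula φ π) Q
follows⇒separates φ sep start = sep
follows⇒separates φ sep (round {Q} {π} π-σ ongoing a) =
  residual-separates (currentFormula φ π) Q (proj₂ ongoing) (proj₁ ongoing)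
    (follows⇒separates φ sep π-σ) a

separable⇒winning : {P : Position n} (φ : Formula n) → Separates φ P →
                    Winning {P = P} (formulaStrategy φ)
separable⇒winning φ sep π π-σ (inj₁ won)       = won
separable⇒winning φ sep {Q} π π-σ (inj₂ (_ , w≡1)) =
  separates-rank1 (currentFormula φ π) Q w≡1 (follows⇒separates φ sep π-σ)

theorem3 : (n : ℕ) → n ≥ 1 → (S R : StringSet n) → Satisfiable ⟦ S ⟧ → Satisfiable ⟦ R ⟧ →
    (w : ℕ) (w≥1 : w ≥ 1) →
    HasWinningStrategy (position w w≥1 S R) ⇔ Σ (Formula n) (λ φ → (size φ ≤ w) × (⟨ S , R ⟩⊨ φ))
theorem3 n _ S R _ _ w w≥1 = mk⇔
  (λ (σ , win) → winning⇒separable σ win start start (<-wellFounded w))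
  (λ (φ , sep) → formulaStrategy φ , separable⇒winning φ sep)
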